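{- Let $G$ be a finite DAG with a weight matrix $C$ supported on $G$, and let $\overline{G}$ be the transitive closure of $G$. There exists a weight matrix $\overline{C}$ supported on $\overline{G}$ such that $\mathcal{M}_*(\overline{G},\overline{C})=\mathcal{M}_*(G,C)$.
   Context: Let $G=(V,E)$ be a finite DAG. A weight matrix supported on $G$ is a $V\times V$ matrix $C=(c_{ij})$ with $c_{ij}\in\mathbb{R}$ if $i\to j\in E$ and $c_{ij}=-\infty$ otherwise. For distinct $i,j\in V$, $P(i,j)$ is the set of directed paths from $i$ to $j$ in $G$, and the weight of a path $\pi$ is $\omega_C(\pi)=\sum_{e\in\pi}c_e$. A path in $P(i,j)$ is critical (for $(G,C)$) if its weight is maximal among all paths in $P(i,j)$; critical paths need not be unique. The transitive closure $\overline G$ is the DAG on $V$ with an edge $i\to j$ whenever $P(i,j)\neq\emptyset$. For $L\subseteq V$, the critical DAG $G^*_{C,L}$ is the DAG on $V$ with an edge $i\to j$ ($i\neq j$) if and only if $P(i,j)\neq\emptyset$ and no critical path from $i$ to $j$ in $(G,C)$ has an interior node in $L$. Distinct $i,j\in V\setminus L$ are $C^*$-connected given $L$ if $G^*_{C,L}$ contains, up to exchanging $i$ and $j$, a path of one of the forms (a) $i\to j$; (b) $i\leftarrow p\to j$; (c) $i\to \ell\leftarrow j$; (d) $i\leftarrow p\to\ell\leftarrow j$; (e) $i\leftarrow p\to\ell\leftarrow q\to j$, with $\ell\in L$ and $p,q\notin L$. Otherwise they are $C^*$-separated given $L$. For pairwise disjoint $I,J,L\subseteq V$, $I$ and $J$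 are $C^*$-separated given $L$ if every $i\in I$ and $j\in J$ are $C^*$-separated given $L$. The maxoid $\mathcal{M}_*(G,C)$ is the set of all triples (CI statements) $[I\perp\!\!\!\perp J\mid L]$ with $I,J,L$ pairwise disjoint such that $I$ and $J$ are $C^*$-separated given $L$ in $(G,C)$. -}

module Defs where

open import Data.Fin using (Fin)
open import Data.Fin.Induction using (spo-noetherian)
open import Data.Fin.Properties using (any?)
open import Data.Fin.Subset using (Subset; _∈_; _∉_; _∩_; Empty)
open import Data.List using (List; []; _∷_)
open import Data.List.Relation.Unary.Any using (Any)
open import Data.Nat as ℕ using (ℕ)
import Data.Nat.Properties as ℕ
open import Data.Product using (∃; ∃-syntax; _×_; _,_; proj₂)
open import Data.Rational as ℚ using (ℚ; 0ℚ; ½; ∣_∣)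
import Data.Rational.Properties as ℚ
open import Data.Rational.Solver using (module +-*-Solver)
open import Data.Sum using (_⊎_; inj₁; inj₂; [_,_]′)
open import Function using (flip)
open import Induction.WellFounded using (Acc; acc)
open import Level using (0ℓ)
open import Relation.Binary using (Rel; Decidable; IsStrictPartialOrder)
open import Relation.Binary.Construct.Closure.Transitive
  using (TransClosure; [_]; _∷_; _++_)
import Relation.Binary.Construct.Add.Infimum.NonStrict as AddInfimum
open import Relation.Binary.PropositionalEquality
  using (_≡_; _≢_; refl; sym; trans; cong; subst; isEquivalence; resp₂)
open import Relation.Nullary using (¬_; Dec; yes; no)
open import Relation.Nullary.Decidable using (map′; _⊎-dec_)
open import Relation.Nullary.Construct.Add.Infimum using (_₋; ⊥₋; [_])
open import Relation.Unary using (Pred)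

-- Real numbers are Cauchy sequences of rationals.  Two sequences denote
-- the same real number when x ≤ᵣ y and y ≤ᵣ x; weights are only ever
-- compared through ≤ᵣ, so no quotient is needed.

record ℝ : Set where
  constructor mkℝ
  field
    seq    : ℕ → ℚ
    cauchy : ∀ ε → 0ℚ ℚ.< ε →
             ∃[ N ] (∀ m n → N ℕ.≤ m → N ℕ.≤ n → ∣ seq m ℚ.- seq n ∣ ℚ.< ε)

open ℝ public

infix 4 _≤ᵣ_

_≤ᵣ_ : Rel ℝ 0ℓ
x ≤ᵣ y = ∀ ε → 0ℚ ℚ.< ε →
         ∃[ N ] (∀ n → N ℕ.≤ n → seq x n ℚ.≤ seq y n ℚ.+ ε)

private
  half>0 : ∀ {ε} → 0ℚ ℚ.< ε → 0ℚ ℚ.< ½ ℚ.* ε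
  half>0 {ε} 0<ε =
    subst (ℚ._< ½ ℚ.* ε) (ℚ.*-zeroʳ ½) (ℚ.*-monoʳ-<-pos ½ 0<ε)

  half+half : ∀ ε → ½ ℚ.* ε ℚ.+ ½ ℚ.* ε ≡ ε
  half+half ε = trans (sym (ℚ.*-distribʳ-+ ε ½ ½)) (ℚ.*-identityˡ ε)

  interchange : ∀ a b c d →
    (a ℚ.+ b) ℚ.- (c ℚ.+ d) ≡ (a ℚ.- c) ℚ.+ (b ℚ.- d)
  interchange = solve 4
    (λ a b c d → (a :+ b) :- (c :+ d) := (a :- c) :+ (b :- d)) refl
    where open +-*-Solver

infixl 6 _+ᵣ_

_+ᵣ_ : ℝ → ℝ → ℝ
seq    (x +ᵣ y) n = seq x n ℚ.+ seq y n
cauchy (x +ᵣ y) ε 0<ε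
  with M , x-close ← cauchy x (½ ℚ.* ε) (half>0 0<ε)
     | N , y-close ← cauchy y (½ ℚ.* ε) (half>0 0<ε)
  = M ℕ.⊔ N , λ m n M⊔N≤m M⊔N≤n → begin-strict
      ∣ (seq x m ℚ.+ seq y m) ℚ.- (seq x n ℚ.+ seq y n) ∣
        ≡⟨ cong ∣_∣ (interchange (seq x m) (seq y m) (seq x n) (seq y n)) ⟩
      ∣ (seq x m ℚ.- seq x n) ℚ.+ (seq y m ℚ.- seq y n) ∣
        ≤⟨ ℚ.∣p+q∣≤∣p∣+∣q∣ (seq x m ℚ.- seq x n) (seq y m ℚ.- seq y n) ⟩
      ∣ seq x m ℚ.- seq x n ∣ ℚ.+ ∣ seq y m ℚ.- seq y n ∣
        <⟨ ℚ.+-mono-<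
             (x-close m n (ℕ.m⊔n≤o⇒m≤o M N M⊔N≤m) (ℕ.m⊔n≤o⇒m≤o M N M⊔N≤n))
             (y-close m n (ℕ.m⊔n≤o⇒n≤o M N M⊔N≤m) (ℕ.m⊔n≤o⇒n≤o M N M⊔N≤n)) ⟩
      ½ ℚ.* ε ℚ.+ ½ ℚ.* ε
        ≡⟨ half+half ε ⟩
      ε ∎
  where open ℚ.≤-Reasoning

-- ℝ ₋ is ℝ ∪ {-∞}, with -∞ written ⊥₋.

open AddInfimum _≤ᵣ_ public using (_≤₋_)

infixl 6 _+₋_

_+₋_ : ℝ ₋ → ℝ ₋ → ℝ ₋
[ x ] +₋ [ y ] = [ x +ᵣ y ]
[ x ] +₋ ⊥₋    = ⊥₋
⊥₋    +₋ _     = ⊥₋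

-- TransClosure Edge i j is the type of directed walks of length at least
-- one from i to j.  By acyclicity, these are exactly the directed paths
-- from i to j, and there are none with i ≡ j.
-- Different proofs of an edge yield paths with the same nodes, which have the
-- same weight and interior, so this multiplicity is harmless.

record DAG (n : ℕ) : Set₁ where
  field
    Edge    : Rel (Fin n) 0ℓ
    edge?   : Decidable Edge
    acyclic : ∀ {i} → ¬ TransClosure Edge i i

  Path : Rel (Fin n) 0ℓ
  Path = TransClosure Edge

open DAG public using (Edge; edge?; acyclic; Path)

private
  variable
    n : ℕ

interior : {E : Rel (Fin n) 0ℓ} {i j : Fin n} →
           TransClosure E i j → List (Fin n)
interior [ _ ]             = []
interior (_∷_ {y = k} _ π) = k ∷ interior π

module _ (G : DAG n) where

  private
    isSPO : IsStrictPartialOrder _≡_ (Path G)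
    isSPO = record
      { isEquivalence = isEquivalence
      ; irrefl        = λ { refl π → acyclic G π }
      ; trans         = _++_
      ; <-resp-≈      = resp₂ (Path G)
      }

    path?′ : ∀ {i} → Acc (flip (Path G)) i → ∀ j → Dec (Path G i j)
    path?′ {i} (acc rec) j = map′ to from
      (edge? G i j ⊎-dec any? step?)
      where
      Step : Fin n → Set
      Step k = Edge G i k × Path G k j

      step? : ∀ k → Dec (Step k)
      step? k with edge? G i k
      ... | yes e = map′ (e ,_) proj₂
                        (path?′ (rec [ e ]) j)
      ... | no ¬e = no λ (e , _) → ¬e e

      to : Edge G i j ⊎ ∃ Step → Path G i j
      to = [ [_] , (λ (_ , e , π) → e ∷ π) ]′

      from : Path G i j → Edge G i j ⊎ ∃ Step
      from [ e ]             = inj₁ e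
      from (_∷_ {y = k} e π) = inj₂ (k , e , π)

  path? : Decidable (Path G)
  path? i = path?′ (spo-noetherian isSPO i)

private
  flatten : ∀ {E : Rel (Fin n) 0ℓ} {i j} →
            TransClosure (TransClosure E) i j → TransClosure E i j
  flatten [ π ]   = π
  flatten (π ∷ ρ) = π ++ flatten ρ

transitiveClosure : DAG n → DAG n
transitiveClosure G = record
  { Edge    = Path G
  ; edge?   = path? G
  ; acyclic = λ π → acyclic G (flatten π)
  }

record WeightMatrix (G : DAG n) : Set where
  field
    entry    : Fin n → Fin n → ℝ ₋
    edge     : ∀ {i j} → Edge G i j → ∃[ c ] entry i j ≡ [ c ]
    non-edge : ∀ {i j} → ¬ Edge G i j → entry i j ≡ ⊥₋

open WeightMatrix public

module _ {G : DAG n} (C : WeightMatrix G) where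

  weight : ∀ {i j} → Path G i j → ℝ ₋
  weight ([_] {i} {j} _)           = entry C i j
  weight (_∷_ {x = i} {y = k} _ π) = entry C i k +₋ weight π

  Critical : ∀ {i j} → Path G i j → Set
  Critical {i} {j} π = ∀ (ρ : Path G i j) → weight ρ ≤₋ weight π

  CriticalEdge : Subset n → Rel (Fin n) 0ℓ
  CriticalEdge L i j =
    i ≢ j × Path G i j ×
    (∀ (π : Path G i j) → Critical π → ¬ Any (_∈ L) (interior π))

  -- The inequalities say that the paths have no repeated nodes.  All other
  -- coincidences are excluded: adjacent nodes are distinct, and ℓ is the
  -- only node in L when i, j ∉ L.

  data ConnectingPath (L : Subset n) (i j : Fin n) : Set where
    form-a : CriticalEdge L i j → ConnectingPath L i j
    form-b : ∀ {p} → p ∉ L →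
             CriticalEdge L p i → CriticalEdge L p j →
             ConnectingPath L i j
    form-c : ∀ {ℓ} → ℓ ∈ L →
             CriticalEdge L i ℓ → CriticalEdge L j ℓ →
             ConnectingPath L i j
    form-d : ∀ {p ℓ} → p ∉ L → ℓ ∈ L → p ≢ j →
             CriticalEdge L p i → CriticalEdge L p ℓ → CriticalEdge L j ℓ →
             ConnectingPath L i j
    form-e : ∀ {p ℓ q} → p ∉ L → ℓ ∈ L → q ∉ L → p ≢ q → p ≢ j → i ≢ q →
             CriticalEdge L p i → CriticalEdge L p ℓ →
             CriticalEdge L q ℓ → CriticalEdge L q j →
             ConnectingPath L i j

  -- Only meaningful for distinct i, j ∉ L.
  Connected : Subset n → Rel (Fin n) 0ℓ
  Connected L i j = ConnectingPath L i j ⊎ ConnectingPath L j i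

  Separated : Subset n → Subset n → Subset n → Set
  Separated I J L = ∀ i j → i ∈ I → j ∈ J → ¬ Connected L i j

Disjoint : Subset n → Subset n → Set
Disjoint I J = Empty (I ∩ J)

-- The triple (I , J , L) encodes the CI statement [I ⫫ J | L].
CIStatement : ℕ → Set
CIStatement n = Subset n × Subset n × Subset n

Maxoid : (G : DAG n) → WeightMatrix G → Pred (CIStatement n) 0ℓ
Maxoid G C (I , J , L) =
  Disjoint I J × Disjoint I L × Disjoint J L × Separated C I J L

{-# OPTIONS --safe #-}

-- Give every edge i → j of the transitive closure that is not an edge of G the
-- weight ω(π) − 1, where π is some path of G from i to j, and keep the weights
-- of the edges of G.  A path through a new edge is then beaten by the path that
-- takes the detour π instead, so the critical paths of the closure are exactly
-- those of G and both critical DAGs agree.  The margin 1 makes the argument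
-- work although the order of the reals is not decidable.

module Submission where

open import Defs
open import Data.Nat using (ℕ)
open import Data.Product using (∃-syntax)
open import Relation.Unary using (_≐_)

open import Data.Empty using (⊥-elim)
open import Data.Fin.Subset using (_∈_)
open import Data.List using (_∷_)
open import Data.List.Relation.Unary.Any using (Any)
open import Data.Nat.Properties using (≤-refl)
open import Data.Product using (_×_; _,_)
open import Data.Rational as ℚ using (ℚ; 0ℚ; 1ℚ; ½)
import Data.Rational.Properties as ℚ
open import Data.Rational.Solver using (module +-*-Solver)
open import Data.Sum as Sum using (_⊎_; inj₁; inj₂)
open import Level using (0ℓ)
open import Relation.Binary using (Rel)
open import Relation.Binary.Construct.Closure.Transitive using ([_]; _∷_; _++_)
import Relation.Binary.Construct.Add.Infimum.NonStrict as AddInfimum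
open import Relation.Binary.PropositionalEquality
  using (_≡_; refl; sym; trans; cong; cong₂; subst; subst₂)
open import Relation.Nullary using (¬_; Dec; yes; no; contradiction)
open import Relation.Nullary.Decidable using (toWitness)
open import Relation.Nullary.Construct.Add.Infimum using (_₋; ⊥₋; [_])

open AddInfimum using (⊥₋≤_; [_])

constant : ℚ → ℝ
seq    (constant q) _       = q
cauchy (constant q) ε 0<ε = 0 , λ _ _ _ _ →
  subst (ℚ._< ε) (sym (cong ℚ.∣_∣ (ℚ.+-inverseʳ q))) 0<ε

-- Compares the representing sequences termwise.  This is stronger than ≤ᵣ, but
-- holds for all the estimates needed here and involves no ε.
record Gap (d : ℚ) (x y : ℝ) : Set where
  constructor pointwise
  field at : ∀ n → d ℚ.+ seq x n ℚ.≤ seq y n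

open Gap

-- `⊥₋` lies below everything by any margin, itself included, so a positive margin is strict only
-- when the left side is finite.
Gap₋ : ℚ → Rel (ℝ ₋) 0ℓ
Gap₋ d = AddInfimum._≤₋_ (Gap d)

gap-reflexive : ∀ {x y} → x ≡ y → Gap₋ 0ℚ x y
gap-reflexive {⊥₋}    refl = ⊥₋≤ _
gap-reflexive {[ x ]} refl =
  [ pointwise (λ n → ℚ.≤-reflexive (ℚ.+-identityˡ (seq x n))) ]

gap-trans : ∀ {d x y z} → Gap₋ d x y → Gap₋ 0ℚ y z → Gap₋ d x z
gap-trans (⊥₋≤ _) _ = ⊥₋≤ _
gap-trans {z = [ z ]} ([_] {l = y} x≤y) [ y≤z ] =
  [ pointwise (λ n → ℚ.≤-trans (at x≤y n)
    (subst (ℚ._≤ seq z n) (ℚ.+-identityˡ (seq y n)) (at y≤z n))) ]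

gap-weaken : ∀ {x y} → Gap₋ 1ℚ x y → Gap₋ 0ℚ x y
gap-weaken (⊥₋≤ _) = ⊥₋≤ _
gap-weaken ([_] {k = x} x<y) = [ pointwise (λ n → ℚ.≤-trans
  (ℚ.+-monoˡ-≤ (seq x n) (toWitness {a? = 0ℚ ℚ.≤? 1ℚ} _)) (at x<y n)) ]

+₋-gap : ∀ {d e x y u v} → Gap₋ d x y → Gap₋ e u v →
         Gap₋ (d ℚ.+ e) (x +₋ u) (y +₋ v)
+₋-gap (⊥₋≤ _) _ = ⊥₋≤ _
+₋-gap [ _ ] (⊥₋≤ _) = ⊥₋≤ _
+₋-gap {d} {e} ([_] {k = x} x≤y) ([_] {k = u} u≤v) = [ pointwise (λ n →
  ℚ.≤-trans (ℚ.≤-reflexive (interchange d e (seq x n) (seq u n)))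
            (ℚ.+-mono-≤ (at x≤y n) (at u≤v n))) ]
  where
  open +-*-Solver
  interchange : ∀ a b c d →
    (a ℚ.+ b) ℚ.+ (c ℚ.+ d) ≡ (a ℚ.+ c) ℚ.+ (b ℚ.+ d)
  interchange = solve 4
    (λ a b c d → (a :+ b) :+ (c :+ d) := (a :+ c) :+ (b :+ d)) refl

-- Finite sums agree termwise, but an equation would also have to identify the sequences as
-- functions and their Cauchy proofs.
+₋-assoc : ∀ x y z → Gap₋ 0ℚ ((x +₋ y) +₋ z) (x +₋ (y +₋ z))
+₋-assoc ⊥₋    _     _     = ⊥₋≤ _
+₋-assoc [ _ ] ⊥₋    _     = ⊥₋≤ _
+₋-assoc [ _ ] [ _ ] ⊥₋    = ⊥₋≤ _
+₋-assoc [ x ] [ y ] [ z ] = [ pointwise (λ n → ℚ.≤-reflexive (trans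
  (ℚ.+-identityˡ _) (ℚ.+-assoc (seq x n) (seq y n) (seq z n)))) ]

decrement : ℝ ₋ → ℝ ₋
decrement x = x +₋ [ constant (ℚ.- 1ℚ) ]

decrement-gap : ∀ x → Gap₋ 1ℚ (decrement x) x
decrement-gap ⊥₋    = ⊥₋≤ _
decrement-gap [ x ] = [ pointwise (λ n → ℚ.≤-reflexive (cancel 1ℚ (seq x n))) ]
  where
  open +-*-Solver
  cancel : ∀ a b → a ℚ.+ (b ℚ.+ ℚ.- a) ≡ b
  cancel = solve 2 (λ a b → a :+ (b :+ :- a) := b) refl

gap-≤₋-trans : ∀ {x y z} → Gap₋ 0ℚ x y → y ≤₋ z → x ≤₋ z
gap-≤₋-trans (⊥₋≤ _) _ = ⊥₋≤ _
gap-≤₋-trans ([_] {k = x} x≤y) [ y≤z ] = [ (λ ε 0<ε →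
  let N , bound = y≤z ε 0<ε in N , λ n N≤n → ℚ.≤-trans
    (subst (ℚ._≤ _) (ℚ.+-identityˡ (seq x n)) (at x≤y n)) (bound n N≤n)) ]

-- At an index `N` for the tolerance `½`, the terms would satisfy 1 + x ≤ y ≤ x + ½. Finiteness
-- excludes the case where both sides are `⊥₋`.
gap⇒≰₋ : ∀ {x y} → ∃[ c ] x ≡ [ c ] → Gap₋ 1ℚ x y → ¬ (y ≤₋ x)
gap⇒≰₋ (x , refl) [ x<y ] [ y≤x ]
  with N , bound ← y≤x ½ (toWitness {a? = 0ℚ ℚ.<? ½} _) =
  ℚ.<-irrefl refl (ℚ.<-≤-trans
    (ℚ.+-monoˡ-< (seq x N) (toWitness {a? = ½ ℚ.<? 1ℚ} _))
    (ℚ.≤-trans (at x<y N)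
      (ℚ.≤-trans (bound N ≤-refl) (ℚ.≤-reflexive (ℚ.+-comm (seq x N) ½)))))

module _ {n : ℕ} {G : DAG n} (C : WeightMatrix G) where

  weight-finite : ∀ {i j} (π : Path G i j) → ∃[ c ] weight C π ≡ [ c ]
  weight-finite [ e ] = edge C e
  weight-finite (e ∷ π)
    with c , eq ← edge C e | d , eq′ ← weight-finite π =
    c +ᵣ d , cong₂ _+₋_ eq eq′

  weight-++ : ∀ {i j k} (π : Path G i j) (ρ : Path G j k) →
              Gap₋ 0ℚ (weight C π +₋ weight C ρ) (weight C (π ++ ρ))
  weight-++ [ _ ] _ = gap-reflexive refl
  weight-++ (_ ∷ π) ρ = gap-trans
    (+₋-assoc _ (weight C π) (weight C ρ))
    (+₋-gap (gap-reflexive refl) (weight-++ π ρ))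

  -- The detour is the one that `path?` returns, so the entry depends on `i` and `j` alone, not on a
  -- proof that they are joined in the closure.
  closureEntry : ∀ {i j} → Dec (Edge G i j) → Dec (Path G i j) → ℝ ₋
  closureEntry {i} {j} (yes _) _       = entry C i j
  closureEntry         (no _)  (yes π) = decrement (weight C π)
  closureEntry         (no _)  (no _)  = ⊥₋

  closureWeights : WeightMatrix (transitiveClosure G)
  entry closureWeights i j = closureEntry (edge? G i j) (path? G i j)
  edge closureWeights {i} {j} π with edge? G i j | path? G i j
  ... | yes e | _     = edge C e
  ... | no _  | no ¬π = contradiction π ¬π
  ... | no _  | yes ρ with c , eq ← weight-finite ρ =
    c +ᵣ constant (ℚ.- 1ℚ) , cong decrement eq
  non-edge closureWeights {i} {j} ¬π with edge? G i j | path? G i j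
  ... | yes e | _     = contradiction [ e ] ¬π
  ... | no _  | yes π = contradiction π ¬π
  ... | no _  | no _  = refl

module _ {n : ℕ} {G : DAG n} (C : WeightMatrix G) where

  private
    Ḡ = transitiveClosure G
    C̄ = closureWeights C

  closureWeights-edge : ∀ {i j} → Edge G i j → entry C̄ i j ≡ entry C i j
  closureWeights-edge {i} {j} e with edge? G i j
  ... | yes _ = refl
  ... | no ¬e = contradiction e ¬e

  embed : ∀ {i j} → Path G i j → Path Ḡ i j
  embed [ e ]   = [ [ e ] ]
  embed (e ∷ π) = [ e ] ∷ embed π

  weight-embed : ∀ {i j} (π : Path G i j) → weight C̄ (embed π) ≡ weight C π
  weight-embed [ e ]   = closureWeights-edge e
  weight-embed (e ∷ π) = cong₂ _+₋_ (closureWeights-edge e) (weight-embed π)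

  interior-embed : ∀ {i j} (π : Path G i j) → interior (embed π) ≡ interior π
  interior-embed [ _ ]   = refl
  interior-embed (_ ∷ π) = cong (_ ∷_) (interior-embed π)

  edgeOrDetour : ∀ {i j} → Path G i j →
    Edge G i j ⊎ ∃[ π ] Gap₋ 1ℚ (entry C̄ i j) (weight C {i} {j} π)
  edgeOrDetour {i} {j} π with edge? G i j | path? G i j
  ... | yes e | _     = inj₁ e
  -- The detour has to be the path `ρ` that defines the entry; the given `π` may weigh less.
  ... | no _  | yes ρ = inj₂ (ρ , decrement-gap _)
  ... | no _  | no ¬π = contradiction π ¬π

  Realised Beaten : ∀ {i j} → Path Ḡ i j → Set
  Realised {i} {j} ρ̄ = ∃[ ρ ]
    weight C {i} {j} ρ ≡ weight C̄ ρ̄ × interior ρ ≡ interior ρ̄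
  Beaten {i} {j} ρ̄ = ∃[ ρ ] Gap₋ 1ℚ (weight C̄ ρ̄) (weight C {i} {j} ρ)

  -- The case split is on whether each step is an edge of `G`, which is decidable, so no reals are
  -- compared. Replacing every new edge by its detour gives the path of `G`; a single replacement
  -- already yields the margin 1.
  realisedOrBeaten : ∀ {i j} (ρ̄ : Path Ḡ i j) → Realised ρ̄ ⊎ Beaten ρ̄
  realisedOrBeaten [ π ] with edgeOrDetour π
  ... | inj₁ e      = inj₁ ([ e ] , sym (closureWeights-edge e) , refl)
  ... | inj₂ beaten = inj₂ beaten
  realisedOrBeaten (π ∷ ρ̄) with edgeOrDetour π | realisedOrBeaten ρ̄
  ... | inj₁ e | inj₁ (ρ , w≡ , int≡) = inj₁
    ( e ∷ ρ
    , cong₂ _+₋_ (sym (closureWeights-edge e)) w≡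
    , cong (_ ∷_) int≡ )
  -- Margins add up, and `0ℚ ℚ.+ 1ℚ` evaluates to `1ℚ`.
  ... | inj₁ e | inj₂ (ρ , gap) = inj₂
    (e ∷ ρ , +₋-gap (gap-reflexive (closureWeights-edge e)) gap)
  ... | inj₂ (σ , gap) | inj₁ (ρ , w≡ , _) = inj₂
    ( σ ++ ρ
    , gap-trans (+₋-gap gap (gap-reflexive (sym w≡))) (weight-++ C σ ρ) )
  -- The margins would add up to 2, so one of them is weakened to 0 first.
  ... | inj₂ (σ , gap) | inj₂ (ρ , gap′) = inj₂
    ( σ ++ ρ
    , gap-trans (+₋-gap gap (gap-weaken gap′)) (weight-++ C σ ρ) )

  dominated : ∀ {i j} (ρ̄ : Path Ḡ i j) →
              ∃[ ρ ] Gap₋ 0ℚ (weight C̄ ρ̄) (weight C {i} {j} ρ)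
  dominated ρ̄ with realisedOrBeaten ρ̄
  ... | inj₁ (ρ , w≡ , _) = ρ , gap-reflexive (sym w≡)
  ... | inj₂ (ρ , gap)    = ρ , gap-weaken gap

  -- Every competitor in the closure is dominated by a path of `G`, which in turn weighs at most as
  -- much as `π`.
  critical-embed : ∀ {i j} (π : Path G i j) →
                   Critical C π → Critical C̄ (embed π)
  critical-embed π π-crit ρ̄ with ρ , gap ← dominated ρ̄ =
    subst (_ ≤₋_) (sym (weight-embed π)) (gap-≤₋-trans gap (π-crit ρ))

  -- A beaten path cannot be critical, because `embed` carries the path that beats it into the
  -- closure at the same weight.
  critical-realised : ∀ {i j} (π̄ : Path Ḡ i j) → Critical C̄ π̄ →
    ∃[ π ] Critical C {i} {j} π × interior π ≡ interior π̄
  critical-realised π̄ π̄-crit with realisedOrBeaten π̄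
  ... | inj₁ (π , w≡ , int≡) = π , π-crit , int≡
    where
    π-crit : Critical C π
    π-crit ρ =
      subst₂ _≤₋_ (weight-embed ρ) (sym w≡) (π̄-crit (embed ρ))
  ... | inj₂ (ρ , gap) = ⊥-elim (gap⇒≰₋ (weight-finite C̄ π̄) gap
    (subst (_≤₋ _) (weight-embed ρ) (π̄-crit (embed ρ))))

  -- Paths are pushed forward by `embed`, while avoidance of `L` is pulled back along
  -- `critical-realised`, which preserves interiors.
  criticalEdge-closure⁺ : ∀ {L i j} →
    CriticalEdge C L i j → CriticalEdge C̄ L i j
  criticalEdge-closure⁺ {L} (i≢j , π , avoids) = i≢j , embed π , avoids′
    where
    avoids′ : ∀ π̄ → Critical C̄ π̄ → ¬ Any (_∈ L) (interior π̄)
    avoids′ π̄ π̄-crit with ρ , ρ-crit , int≡ ← critical-realised π̄ π̄-crit =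
      subst (λ xs → ¬ Any (_∈ L) xs) int≡ (avoids ρ ρ-crit)

  criticalEdge-closure⁻ : ∀ {L i j} →
    CriticalEdge C̄ L i j → CriticalEdge C L i j
  criticalEdge-closure⁻ {L} (i≢j , π̄ , avoids)
    -- Here `dominated` serves to turn `π̄` into a path of `G`.
    with ρ , _ ← dominated π̄ = i≢j , ρ , λ π π-crit →
    subst (λ xs → ¬ Any (_∈ L) xs) (interior-embed π)
      (avoids (embed π) (critical-embed π π-crit))

module _ {n : ℕ} {G H : DAG n} {C : WeightMatrix G} {D : WeightMatrix H} where

  connectingPath-map : ∀ {L} →
    (∀ {i j} → CriticalEdge C L i j → CriticalEdge D L i j) →
    ∀ {i j} → ConnectingPath C L i j → ConnectingPath D L i j
  connectingPath-map f (form-a a)         = form-a (f a)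
  connectingPath-map f (form-b p∉ a b)    = form-b p∉ (f a) (f b)
  connectingPath-map f (form-c ℓ∈ a b)    = form-c ℓ∈ (f a) (f b)
  connectingPath-map f (form-d p∉ ℓ∈ p≢j a b c) =
    form-d p∉ ℓ∈ p≢j (f a) (f b) (f c)
  connectingPath-map f (form-e p∉ ℓ∈ q∉ p≢q p≢j i≢q a b c d) =
    form-e p∉ ℓ∈ q∉ p≢q p≢j i≢q (f a) (f b) (f c) (f d)

  -- More critical edges mean more connecting paths and hence fewer separations.
  maxoid-antitone :
    (∀ {L i j} → CriticalEdge C L i j → CriticalEdge D L i j) →
    ∀ {s} → Maxoid H D s → Maxoid G C s
  maxoid-antitone f (I∩J , I∩L , J∩L , sep) =
    I∩J , I∩L , J∩L , λ i j i∈I j∈J connected →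
      sep i j i∈I j∈J
        (Sum.map (connectingPath-map f) (connectingPath-map f) connected)

lemma2p5 : ∀ {n : ℕ} (G : DAG n) (C : WeightMatrix G) →
    ∃[ C̄ ] (Maxoid (transitiveClosure G) C̄ ≐ Maxoid G C)
lemma2p5 G C = closureWeights C ,
  maxoid-antitone (criticalEdge-closure⁺ C) ,
  maxoid-antitone (criticalEdge-closure⁻ C)
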